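{- Let $G_0,G_1\in\mathbb{Z}$ and let $(G_n)_{n\ge 0}$ be defined by $G_n=G_{n-1}+G_{n-2}$ for $n\ge 2$. For every integer $k \geq 1$, $$\mathcal{G}^2_{G_0,G_1}(k) = \gcd\left(G_k G_{k+1} - G_0 G_1,\; G_{k+1}^2 - G_1^2,\; G_{k+2}^2 - G_2^2\right),$$ where $\mathcal{G}^2_{G_0,G_1}(k)$ denotes the greatest common divisor of all the integers $\sum_{i=1}^k G_{n+i}^2$ for $n \ge 0$.
   Context: $(G_n)_{n\ge0}$ is a generalized Fibonacci (Gibonacci) sequence with arbitrary integer initial values $G_0,G_1$. $\mathcal{G}^2_{G_0,G_1}(k)=\gcd\{\sum_{i=1}^k G_{n+i}^2 : n\ge 0\}$, the gcd of the infinitely many sums of $k$ consecutive squares starting after index $n$ (taken nonnegative). -}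

module Defs where

open import Data.Nat.Base as ℕ using (ℕ; zero; suc)
open import Data.Nat.Divisibility using (∣-antisym)
open import Data.Integer.Base using (ℤ; 0ℤ; _+_; _≤_; _^_)
open import Data.Integer.Divisibility using (_∣_)
open import Data.Integer.Properties using (0≤i⇒+∣i∣≡i)
open import Relation.Binary.PropositionalEquality using (_≡_; sym; trans; cong)

gibonacci : (G₀ G₁ : ℤ) → ℕ → ℤ
gibonacci G₀ G₁ zero          = G₀
gibonacci G₀ G₁ (suc zero)    = G₁
gibonacci G₀ G₁ (suc (suc n)) = gibonacci G₀ G₁ (suc n) + gibonacci G₀ G₁ n

-- ∑[i=1… k ] f  is  f 1 + f 2 + … + f k.
∑[i=1…_] : ℕ → (ℕ → ℤ) → ℤ
∑[i=1… zero  ] f = 0ℤ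
∑[i=1… suc k ] f = ∑[i=1… k ] f + f (suc k)

-- The gcd of an infinite family cannot be computed from the family alone, so
-- it is given as a relation. "Greatest" is with respect to divisibility, so
-- the gcd of the zero family is 0.
record IsGCD (a : ℕ → ℤ) (g : ℤ) : Set where
  field
    nonNegative   : 0ℤ ≤ g
    commonDivisor : ∀ n → g ∣ a n
    greatest      : ∀ d → (∀ n → d ∣ a n) → d ∣ g

IsGCD-unique : ∀ {a g h} → IsGCD a g → IsGCD a h → g ≡ h
IsGCD-unique {a} {g} {h} G H =
  trans (sym (0≤i⇒+∣i∣≡i (nonNegative G)))
    (trans (cong ℤ.pos (∣-antisym (greatest H g (commonDivisor G))
                                  (greatest G h (commonDivisor H))))
           (0≤i⇒+∣i∣≡i (nonNegative H)))
  where open IsGCD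

-- Is𝒢² G₀ G₁ k g  reads  𝒢²_{G₀,G₁}(k) = g.
Is𝒢² : (G₀ G₁ : ℤ) (k : ℕ) (g : ℤ) → Set
Is𝒢² G₀ G₁ k = IsGCD (λ n → ∑[i=1… k ] (λ i → gibonacci G₀ G₁ (n ℕ.+ i) ^ 2))

{-# OPTIONS --safe #-}
-- With P m = G m * G (m + 1), the sum S n of k consecutive squares after index n
-- telescopes to P (n + k) - P n. Like squares and products of adjacent terms of G,
-- S satisfies S (n + 3) = 2 S (n + 2) + 2 S (n + 1) - S n, so the gcd of all S n
-- is that of S 0, S 1 - S 0 and S 2 - S 1.
module Submission where

open import Defs
open import Data.Nat.Base as ℕ using (ℕ; zero; suc)
open import Data.Nat.Properties as ℕ using ()
open import Data.Integer.Base using (ℤ; +_; _+_; _-_; _*_; _^_; +≤+)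
open import Data.Integer.GCD using (gcd; gcd[i,j]∣i; gcd[i,j]∣j; gcd-greatest)
open import Data.Integer.Divisibility using () renaming (_∣_ to _∣ᵤ_)
open import Data.Integer.Divisibility.Signed
  using (_∣_; ∣ᵤ⇒∣; ∣⇒∣ᵤ; ∣-trans; ∣m∣n⇒∣m+n; ∣m∣n⇒∣m-n; ∣m⇒∣-m; ∣m+n∣n⇒∣m; ∣n⇒∣m*n)
open import Data.Integer.Properties using (+-inverseʳ)
open import Data.Integer.Tactic.RingSolver using (solve-∀)
open import Relation.Binary.PropositionalEquality
  using (_≡_; sym; cong₂; subst)

-- The characteristic polynomial x³ - 2x² - 2x + 1 = (x + 1)(x² - 3x + 1) has roots φ², φψ = -1 and
-- ψ², where φ and ψ are the roots of x² - x - 1.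
SquareRecurrence : (ℕ → ℤ) → Set
SquareRecurrence a = ∀ n → a (3 ℕ.+ n) ≡ + 2 * a (2 ℕ.+ n) + + 2 * a (1 ℕ.+ n) - a n

module _ {a : ℕ → ℤ} (rec : SquareRecurrence a) where

  ∣-all : ∀ {d} → d ∣ a 0 → d ∣ a 1 → d ∣ a 2 → ∀ n → d ∣ a n
  ∣-all     d₀ d₁ d₂ 0 = d₀
  ∣-all     d₀ d₁ d₂ 1 = d₁
  ∣-all     d₀ d₁ d₂ 2 = d₂
  ∣-all {d} d₀ d₁ d₂ (suc (suc (suc n))) = subst (d ∣_) (sym (rec n))
    (∣m∣n⇒∣m-n
      (∣m∣n⇒∣m+n (∣n⇒∣m*n (+ 2) (∣-all d₀ d₁ d₂ (suc (suc n))))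
                 (∣n⇒∣m*n (+ 2) (∣-all d₀ d₁ d₂ (suc n))))
      (∣-all d₀ d₁ d₂ n))

  -- The differences generate the same ideal as `a 0`, `a 1`, `a 2`; for `a = S k` they become
  -- differences of two squares.
  isGCD-differences : IsGCD a (gcd (gcd (a 0) (a 1 - a 0)) (a 2 - a 1))
  isGCD-differences = record
    { nonNegative   = +≤+ ℕ.z≤n
    ; commonDivisor = λ n → ∣⇒∣ᵤ (∣-all g∣a₀ g∣a₁ g∣a₂ n)
    ; greatest      = λ d d∣a →
        gcd-greatest {h} {a 2 - a 1} {d}
          (gcd-greatest {a 0} {a 1 - a 0} {d} (d∣a 0) (∣-difference d d∣a 1 0))
          (∣-difference d d∣a 2 1)
    }
    where
    h g : ℤ
    h = gcd (a 0) (a 1 - a 0)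
    g = gcd h (a 2 - a 1)

    ∣-difference : ∀ d → (∀ n → d ∣ᵤ a n) → ∀ m n → d ∣ᵤ a m - a n
    ∣-difference d d∣a m n =
      ∣⇒∣ᵤ (∣m∣n⇒∣m-n {d} {a m} {a n} (∣ᵤ⇒∣ (d∣a m)) (∣ᵤ⇒∣ (d∣a n)))

    g∣h : g ∣ h
    g∣h = ∣ᵤ⇒∣ (gcd[i,j]∣i h (a 2 - a 1))

    g∣a₀ : g ∣ a 0
    g∣a₀ = ∣-trans g∣h (∣ᵤ⇒∣ (gcd[i,j]∣i (a 0) (a 1 - a 0)))

    g∣a₁ : g ∣ a 1
    -- `a 1 - a 0` unfolds to `a 1 + - a 0`, and the second summand is cancelled.
    g∣a₁ = ∣m+n∣n⇒∣m
      (∣-trans g∣h (∣ᵤ⇒∣ (gcd[i,j]∣j (a 0) (a 1 - a 0)))) (∣m⇒∣-m g∣a₀)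

    g∣a₂ : g ∣ a 2
    g∣a₂ = ∣m+n∣n⇒∣m (∣ᵤ⇒∣ (gcd[i,j]∣j h (a 2 - a 1))) (∣m⇒∣-m g∣a₁)

module _ (G₀ G₁ : ℤ) where

  private
    G P : ℕ → ℤ
    G = gibonacci G₀ G₁
    P n = G n * G (suc n)

    S : ℕ → ℕ → ℤ
    S k n = ∑[i=1… k ] (λ i → G (n ℕ.+ i) ^ 2)

  -- Since G (m + 2) - G m = G (m + 1), each square G (m + 1) ^ 2 equals P (m + 1) - P m.
  sum-squares : ∀ k n → S k n ≡ P (n ℕ.+ k) - P n
  sum-squares zero    n rewrite ℕ.+-identityʳ n = sym (+-inverseʳ (P n))
  sum-squares (suc k) n rewrite sum-squares k n | ℕ.+-suc n k =
    step (G (n ℕ.+ k)) (G (suc (n ℕ.+ k))) (P n)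
    where
    -- y ^ 2 is written in its unfolded form because the ring solver rejects _^_ on ℤ.
    step : ∀ x y p → x * y - p + y * (y * + 1) ≡ y * (y + x) - p
    step = solve-∀

  sum-squares-recurrence : ∀ k → SquareRecurrence (S k)
  sum-squares-recurrence k n
    rewrite sum-squares k n | sum-squares k (1 ℕ.+ n)
          | sum-squares k (2 ℕ.+ n) | sum-squares k (3 ℕ.+ n) =
    -- All later terms unfold to sums of these four, so a polynomial identity in free variables
    -- remains.
    identity (G (n ℕ.+ k)) (G (suc (n ℕ.+ k))) (G n) (G (suc n))
    where
    identity : ∀ x y u v →
      (y + x + y) * (y + x + y + (y + x))
        - (v + u + v) * (v + u + v + (v + u))
      ≡ + 2 * ((y + x) * (y + x + y) - (v + u) * (v + u + v))
        + + 2 * (y * (y + x) - v * (v + u)) - (x * y - u * v)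
    identity = solve-∀

  -- Sliding the window by one index brings in one new square and drops the oldest.
  sum-squares-difference : ∀ k n →
    S k (suc n) - S k n ≡ G (suc (n ℕ.+ k)) ^ 2 - G (suc n) ^ 2
  sum-squares-difference k n rewrite sum-squares k n | sum-squares k (suc n) =
    identity (G (n ℕ.+ k)) (G (suc (n ℕ.+ k))) (G n) (G (suc n))
    where
    identity : ∀ x y u v →
      y * (y + x) - v * (v + u) - (x * y - u * v) ≡ y * (y * + 1) - v * (v * + 1)
    identity = solve-∀

theorem3p4 : (G₀ G₁ : ℤ) (k : ℕ) → k ℕ.≥ 1 →
    let G = gibonacci G₀ G₁ in
    Is𝒢² G₀ G₁ k
    (gcd (gcd (G k * G (k ℕ.+ 1) - G 0 * G 1)
    (G (k ℕ.+ 1) ^ 2 - G 1 ^ 2))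
    (G (k ℕ.+ 2) ^ 2 - G 2 ^ 2))
-- As `1 + k` and `2 + k` the indices reduce to `suc (0 + k)` and `suc (1 + k)`, the windows at n =
-- 0 and n = 1.
theorem3p4 G₀ G₁ k _ rewrite ℕ.+-comm k 1 | ℕ.+-comm k 2 =
  subst (Is𝒢² G₀ G₁ k)
    (cong₂ gcd (cong₂ gcd (sum-squares G₀ G₁ k 0) (sum-squares-difference G₀ G₁ k 0))
               (sum-squares-difference G₀ G₁ k 1))
    (isGCD-differences (sum-squares-recurrence G₀ G₁ k))
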